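{- Let $\mathbf P$ be a CFSM protocol with the recognizable channel property and communication graph $(N,E)$. A global state $(S',C')$ is not reachable if and only if there is a family of recognizable relations $\mathbf R(S)\subseteq\prod_{\xi\in E}M_\xi^*$, $S\in\prod_{j\in N}K_j$, consistent with respect to $\mathbf P$, such that $C^0\in\mathbf R(S^0)$ and $C'\notin\mathbf R(S')$.
   Context: A CFSM protocol $\mathbf P$ has a finite directed communication graph $G=(N,E)$ (edge $\xi$ has tail $-\xi$, head $+\xi$), pairwise disjoint finite message sets $M_\xi$, and for each $j\in N$ a finite state machine $F_j=(K_j,\Sigma_j,T_j,h_j)$: finite state set $K_j$, initial state $h_j$, alphabet $\Sigma_j=\{+b: b\in M_\xi,\ j=+\xi\}\cup\{ -b: b\in M_\xi,\ j=-\xi\}$, transitions $T_j\subseteq K_j\times\Sigma_j\times K_j$ ($+b$ = receive, $-b$ = send). A composite state is $S=(p_j:j\in N)$; a channel content is $C=(x_\xi:\xi\in E)$, $x_\xi\in M_\xi^*$; global states are pairs $(S,C)$; $C^0$ has all components empty; $S^0=(h_j:j\in N)$; $(S^0,C^0)$ is the initial global state. A step: some machine $F_i$ takes $p_i\xrightarrow{ -b}q_i$ with $b\in M_\beta$, $i=-\beta$, appending $b$ to the end of $x_\beta$; or takes $p_i\xrightarrow{+b}q_i$ with $b\in M_\beta$, $i=+\beta$, provided $x_\beta$ begins with $b$, removing it; all else unchanged. $\vdash^*$ means reachability by finitely many steps; reachable means $(S^0,C^0)\vdash^*$ it. A relation in $\prod_{\xi\in E}M_\xi^*$ is recognizable if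 it is a finite union of sets $\prod_\xi L_\xi$ with $L_\xi\subseteq M_\xi^*$ regular. $\mathbf P$ has the recognizable channel property if $\mathbf L(S)=\{C:(S^0,C^0)\vdash^*(S,C)\}$ is recognizable for every $S$. A family $\mathbf R(S)$ is consistent if $(S,C)\vdash^*(S',C')$ and $C\in\mathbf R(S)$ imply $C'\in\mathbf R(S')$. -}

module Defs where

open import Data.Fin using (Fin)
open import Data.Fin.Subset using (Subset) renaming (_∈_ to _∈ˢ_)
open import Data.List using (List; []; _∷_; _∷ʳ_; foldl)
open import Data.Nat using (ℕ)
open import Data.Product using (_×_; _,_; ∃; ∃-syntax)
open import Function using (_↔_)
open import Level using (0ℓ)
open import Relation.Binary using (Rel)
open import Relation.Binary.Construct.Closure.ReflexiveTransitive using (Star)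
open import Relation.Binary.PropositionalEquality using (_≡_; _≢_)
open import Relation.Unary using (Pred; _∈_; _≐_; ⋃)

Finite : Set → Set
Finite A = ∃[ n ] (A ↔ Fin n)

record DFA (A : Set) : Set where
  field
    size  : ℕ
    δ     : Fin size → A → Fin size
    start : Fin size
    final : Subset size

  Language : Pred (List A) 0ℓ
  Language w = foldl δ start w ∈ˢ final

Regular : {A : Set} → Pred (List A) 0ℓ → Set
Regular {A} L = ∃ λ (D : DFA A) → L ≐ DFA.Language D

record Graph : Set₁ where
  field
    N E       : Set
    N-finite  : Finite N
    E-finite  : Finite E
    tail head : E → N

-- Σ_j: machine j receives (+ b) the messages of its incoming edges and sends
-- (- b) those of its outgoing edges.
data Alphabet (G : Graph) (M : Graph.E G → Set) : Graph.N G → Set where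
  +_ : {ξ : Graph.E G} → M ξ → Alphabet G M (Graph.head G ξ)
  -_ : {ξ : Graph.E G} → M ξ → Alphabet G M (Graph.tail G ξ)

record FSM (A : Set) : Set₁ where
  field
    K        : Set
    K-finite : Finite K
    T        : Pred (K × A × K) 0ℓ
    h        : K

-- The message sets are pairwise disjoint because a message always carries its
-- edge: the set of all messages is the disjoint union Σ E M.
record Protocol : Set₁ where
  field
    G : Graph

  open Graph G public

  field
    M        : E → Set
    M-finite : (ξ : E) → Finite (M ξ)
    F        : (j : N) → FSM (Alphabet G M j)

  open module Machine (j : N) = FSM (F j) public

  CompositeState : Set
  CompositeState = (j : N) → K j

  ChannelContent : Set
  ChannelContent = (ξ : E) → List (M ξ)

  GlobalState : Set
  GlobalState = CompositeState × ChannelContent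

  S⁰ : CompositeState
  S⁰ = h

  C⁰ : ChannelContent
  C⁰ ξ = []

  -- Global states are tuples, so they are identified when they agree
  -- componentwise; without function extensionality this is weaker than _≡_.
  _≈_ : Rel GlobalState 0ℓ
  (S , C) ≈ (S′ , C′) = (∀ j → S j ≡ S′ j) × (∀ ξ → C ξ ≡ C′ ξ)

  data _⊢_ : Rel GlobalState 0ℓ where
    send : ∀ {S C S′ C′} (β : E) (b : M β) →
           (S (tail β) , - b , S′ (tail β)) ∈ T (tail β) →
           (∀ j → j ≢ tail β → S′ j ≡ S j) →
           C′ β ≡ C β ∷ʳ b →
           (∀ ξ → ξ ≢ β → C′ ξ ≡ C ξ) →
           (S , C) ⊢ (S′ , C′)
    receive : ∀ {S C S′ C′} (β : E) (b : M β) →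
              (S (head β) , + b , S′ (head β)) ∈ T (head β) →
              (∀ j → j ≢ head β → S′ j ≡ S j) →
              C β ≡ b ∷ C′ β →
              (∀ ξ → ξ ≢ β → C′ ξ ≡ C ξ) →
              (S , C) ⊢ (S′ , C′)

  -- The final _≈_ matters only for runs of length zero: _⊢_ itself is already
  -- invariant under _≈_ on both sides.
  _⊢*_ : Rel GlobalState 0ℓ
  g ⊢* g′ = ∃[ k ] (Star _⊢_ g k × k ≈ g′)

  Reachable : Pred GlobalState 0ℓ
  Reachable g = (S⁰ , C⁰) ⊢* g

  ∏ : ((ξ : E) → Pred (List (M ξ)) 0ℓ) → Pred ChannelContent 0ℓ
  ∏ L C = ∀ ξ → C ξ ∈ L ξ

  Recognizable : Pred ChannelContent 0ℓ → Set₁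
  Recognizable R =
    ∃ λ (n : ℕ) → ∃ λ (L : Fin n → (ξ : E) → Pred (List (M ξ)) 0ℓ) →
      (∀ i ξ → Regular (L i ξ)) × R ≐ ⋃ (Fin n) (λ i → ∏ (L i))

  𝐋 : CompositeState → Pred ChannelContent 0ℓ
  𝐋 S C = Reachable (S , C)

  RecognizableChannelProperty : Set₁
  RecognizableChannelProperty = ∀ S → Recognizable (𝐋 S)

  Consistent : (CompositeState → Pred ChannelContent 0ℓ) → Set
  Consistent R = ∀ S C S′ C′ → (S , C) ⊢* (S′ , C′) → C ∈ R S → C′ ∈ R S′

{-# OPTIONS --safe #-}
module Submission where

-- The family 𝐋 itself separates: it is recognizable by hypothesis, and
-- consistent because ⊢* is transitive.

open import Defs
open import Data.List using (_∷ʳ_)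
open import Data.Product using (_×_; _,_; ∃)
open import Function using (_⇔_; mk⇔)
open import Level using (0ℓ)
open import Relation.Binary using (Transitive)
open import Relation.Binary.Construct.Closure.ReflexiveTransitive using (ε; _◅_; _◅◅_)
open import Relation.Binary.PropositionalEquality using (refl; sym; trans; cong; subst)
open import Relation.Nullary using (¬_)
open import Relation.Unary using (Pred; _∈_; _∉_)

-- The sets `𝐋 S` form the least consistent family with `C⁰` at `S⁰`: consistency carries `C⁰` along
-- any run. So a family omitting `C′` at `S′` rules out reachability, and conversely `𝐋` omits every
-- unreachable state. The work is in composing runs, since `_⊢*_` ends with an `≈`.

module _ (P : Protocol) where
  open Protocol P

  ≈-refl : ∀ {g} → g ≈ g
  ≈-refl = (λ _ → refl) , (λ _ → refl)

  ≈-trans : Transitive _≈_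
  ≈-trans (p , q) (p′ , q′) = (λ j → trans (p j) (p′ j)) , (λ ξ → trans (q ξ) (q′ ξ))

  -- A step refers to its source only through values at single machines and channels, so pointwise
  -- equality suffices and no function extensionality is needed.
  ⊢-respˡ-≈ : ∀ {g g′ k} → k ≈ g → g ⊢ g′ → k ⊢ g′
  ⊢-respˡ-≈ (p , q) (send {S′ = S′} β b t s c d) =
    send β b (subst (λ x → (x , - b , S′ (tail β)) ∈ T (tail β)) (sym (p (tail β))) t)
      (λ j j≢ → trans (s j j≢) (sym (p j)))
      (trans c (cong (_∷ʳ b) (sym (q β))))
      (λ ξ ξ≢ → trans (d ξ ξ≢) (sym (q ξ)))
  ⊢-respˡ-≈ (p , q) (receive {S′ = S′} β b t s c d) =
    receive β b (subst (λ x → (x , + b , S′ (head β)) ∈ T (head β)) (sym (p (head β))) t)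
      (λ j j≢ → trans (s j j≢) (sym (p j)))
      (trans (q β) c)
      (λ ξ ξ≢ → trans (d ξ ξ≢) (sym (q ξ)))

  -- The first run stops at some `k ≈ g`, while the second starts at `g`. Only the first step of the
  -- second run has to be moved to `k`: its target stays the same, so the remaining steps fit
  -- unchanged. If there is no such step, the two `≈` compose.
  ⊢*-trans : Transitive _⊢*_
  ⊢*-trans (k , r , k≈g) (_ , ε , g≈g′) = k , r , ≈-trans k≈g g≈g′
  ⊢*-trans (k , r , k≈g) (l , x ◅ xs , l≈g′) = l , r ◅◅ (⊢-respˡ-≈ k≈g x ◅ xs) , l≈g′

  𝐋-consistent : Consistent 𝐋
  𝐋-consistent _ _ _ _ run reach = ⊢*-trans reach run

  C⁰∈𝐋S⁰ : C⁰ ∈ 𝐋 S⁰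
  C⁰∈𝐋S⁰ = _ , ε , ≈-refl

theorem9p5 : (P : Protocol) → let open Protocol P in
    RecognizableChannelProperty →
    (S′ : CompositeState) (C′ : ChannelContent) →
    (¬ Reachable (S′ , C′)) ⇔
    (∃ λ (R : CompositeState → Pred ChannelContent 0ℓ) →
    (∀ S → Recognizable (R S)) × Consistent R × C⁰ ∈ R S⁰ × C′ ∉ R S′)
theorem9p5 P rcp S′ C′ = mk⇔
  (λ unreachable → 𝐋 , rcp , 𝐋-consistent P , C⁰∈𝐋S⁰ P , unreachable)
  (λ (R , _ , consistent , C⁰∈R , C′∉R) run → C′∉R (consistent S⁰ C⁰ S′ C′ run C⁰∈R))
  where open Protocol P
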